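{- Let $k\ge 2$ and let $F,F'$ be minimally unsatisfiable 2-CNFs of deficiency $k$. Then the set of isomorphisms $f:F\to F'$ (as maps from the literals of $F$ to the literals of $F'$) equals the set of digraph isomorphisms $f:\mathrm{idg}(F)\to\mathrm{idg}(F')$ (as maps between vertex sets).
   Context: Literals are variables and their complements; a clause is a finite set of literals without complementary pair; a 2-CNF is a finite set of clauses of size at most 2. Deficiency $\delta(F)=|F|-n(F)$, $n(F)$ the number of variables. Minimally unsatisfiable: unsatisfiable, and removing any clause makes it satisfiable. An isomorphism $F\to F'$ is a bijection $f$ from the literals of $F$ to those of $F'$ with $f(\overline x)=\overline{f(x)}$ and $\{f(C):C\in F\}=F'$. For a 2-CNF $F$ without empty clause, $\mathrm{idg}(F)$ has vertex set the literals over variables of $F$, arcs $(\overline x,x)$ for unit-clauses $\{x\}$, and arcs $(\overline x,y),(\overline y,x)$ for clauses $\{x,y\}$, $x\neq y$. A digraph isomorphism is a bijection of vertex sets mapping the arc set exactly onto the arc set. -}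

module Defs where

open import Data.Nat using (ℕ; _≟_; _≤_; _+_)
open import Data.Bool using (Bool; true; false; not)
open import Data.List using (List; []; _∷_; map; concat; length; deduplicate; removeAt)
open import Data.List.Membership.Propositional using (_∈_)
open import Data.List.Relation.Unary.All using (All)
open import Data.List.Relation.Unary.Any using (Any)
open import Data.List.Relation.Unary.Unique.Propositional using (Unique)
open import Data.List.Relation.Unary.AllPairs using (AllPairs)
open import Data.Fin using (Fin)
open import Data.Product using (Σ; _×_; ∃; _,_)
open import Data.Sum using (_⊎_)
open import Data.Empty using (⊥)
open import Relation.Nullary using (¬_)
open import Relation.Binary.PropositionalEquality using (_≡_)
open import Function.Bundles using (_⇔_)

data Lit : Set where
  pos : ℕ → Lit
  neg : ℕ → Lit

var : Lit → ℕ
var (pos v) = v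
var (neg v) = v

compl : Lit → Lit
compl (pos v) = neg v
compl (neg v) = pos v

-- A clause is a finite set of literals, represented by a duplicate-free list.
Clause : Set
Clause = List Lit

-- A CNF is a finite set of clauses, represented by a list of clauses
-- no two of which are equal as sets.
CNF : Set
CNF = List Clause

_≈C_ : Clause → Clause → Set
C ≈C D = ∀ l → (l ∈ C) ⇔ (l ∈ D)

WFClause : Clause → Set
WFClause C = Unique C × (∀ l → l ∈ C → ¬ (compl l ∈ C))

Is2CNF : CNF → Set
Is2CNF F = All (λ C → WFClause C × length C ≤ 2) F × AllPairs (λ C D → ¬ (C ≈C D)) F

vars : CNF → List ℕ
vars F = deduplicate _≟_ (map var (concat F))

nvars : CNF → ℕ
nvars F = length (vars F)

-- |F| = length F (clauses distinct by Is2CNF); deficiency δ(F) = |F| - n(F) = k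
HasDeficiency : CNF → ℕ → Set
HasDeficiency F k = length F ≡ nvars F + k

Assignment : Set
Assignment = ℕ → Bool

SatLit : Assignment → Lit → Set
SatLit α (pos v) = α v ≡ true
SatLit α (neg v) = α v ≡ false

SatClause : Assignment → Clause → Set
SatClause α C = Any (SatLit α) C

SatCNF : Assignment → CNF → Set
SatCNF α F = All (SatClause α) F

Satisfiable : CNF → Set
Satisfiable F = ∃ λ α → SatCNF α F

Unsatisfiable : CNF → Set
Unsatisfiable F = ¬ Satisfiable F

MinUnsat : CNF → Set
MinUnsat F = Unsatisfiable F × (∀ (i : Fin (length F)) → Satisfiable (removeAt F i))

-- literals of F: literals over the variables of F (= vertex set of idg(F))
LitOf : CNF → Lit → Set
LitOf F l = var l ∈ vars F

BijOn : (Lit → Set) → (Lit → Set) → (Lit → Lit) → Set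
BijOn P Q f =
  (∀ x → P x → Q (f x)) ×
  (∀ x y → P x → P y → f x ≡ f y → x ≡ y) ×
  (∀ y → Q y → ∃ λ x → P x × f x ≡ y)

IsIso : CNF → CNF → (Lit → Lit) → Set
IsIso F F' f =
  BijOn (LitOf F) (LitOf F') f ×
  (∀ x → LitOf F x → f (compl x) ≡ compl (f x)) ×
  (∀ C → C ∈ F → ∃ λ D → D ∈ F' × (map f C ≈C D)) ×
  (∀ D → D ∈ F' → ∃ λ C → C ∈ F × (map f C ≈C D))

ArcFrom : Clause → Lit → Lit → Set
ArcFrom (x ∷ []) u v = u ≡ compl x × v ≡ x
ArcFrom (x ∷ y ∷ []) u v = (u ≡ compl x × v ≡ y) ⊎ (u ≡ compl y × v ≡ x)
ArcFrom _ u v = ⊥   -- empty clause (excluded for MU, δ ≥ 2) or size > 2 (excluded by Is2CNF)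

Arc : CNF → Lit → Lit → Set
Arc F u v = Any (λ C → ArcFrom C u v) F

IsDigraphIso : CNF → CNF → (Lit → Lit) → Set
IsDigraphIso F F' f =
  BijOn (LitOf F) (LitOf F') f ×
  (∀ u v → Arc F u v → Arc F' (f u) (f v)) ×
  (∀ u' v' → Arc F' u' v' → ∃ λ u → ∃ λ v → Arc F u v × f u ≡ u' × f v ≡ v')

{-# OPTIONS --safe #-}

-- The point is that a digraph isomorphism f commutes with complementation, i.e. that
-- complementation σ and its pullback σ′ = f⁻¹ ∘ compl ∘ f agree on G = idg(F). Both are skew
-- symmetries of G, and by minimal unsatisfiability every closed walk through x and σ x,
-- together with its mirror image, contains all arcs; likewise for σ′. Hence a shortest closed
-- walk W through x and σ x (or its mirror image) passes through σ′ x, and W is also shortest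
-- through x and σ′ x. If σ x ≠ σ′ x, comparing W with the walks obtained by reflecting parts
-- of it shows that x has a single out-neighbour, at which σ and σ′ differ again. As G is
-- strongly connected, all out-degrees are then 1, so every literal occurs at most once in F,
-- and F has at least 2k ≥ 4 unit clauses. But three unit clauses {a}, {b}, {c} are impossible:
-- if b̄ is at least as near to a as c̄ is, then a → b̄ → b → ā → a is contradictory without c.

module Submission where

open import Defs
open import Data.Bool using (true; false; if_then_else_)
open import Data.Nat using (ℕ; suc; _+_; _≤_; _<_; z≤n; s≤s; _≟_)
open import Data.Nat.Properties
open import Data.Nat.Induction using (<-rec)
open import Data.Nat.Tactic.RingSolver using (solve-∀)
open import Data.Fin using (zero; suc)
open import Data.List using (List; []; _∷_; map; concat; length; removeAt; lookup; _++_)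
open import Data.List.Properties using (length-++; length-map)
open import Data.List.Membership.Propositional using (_∈_; find; lose)
open import Data.List.Membership.Propositional.Properties
open import Data.List.Membership.DecPropositional _≟_ using (_∈?_)
open import Data.List.Relation.Unary.All as All using (All; []; _∷_)
open import Data.List.Relation.Unary.Any using (Any; here; there; index)
open import Data.List.Relation.Unary.AllPairs using (AllPairs; []; _∷_)
open import Data.List.Relation.Unary.Unique.Propositional using (Unique)
open import Data.List.Relation.Unary.Unique.Propositional.Properties using (concat⁺)
open import Data.List.Relation.Binary.Disjoint.Propositional using (Disjoint)
open import Data.Product using (Σ-syntax; ∃; ∃₂; _×_; _,_; proj₁; proj₂)
open import Data.Sum as Sum using (_⊎_; inj₁; inj₂; [_,_]′)
open import Data.Empty using (⊥)
open import Function.Base using (case_of_; id)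
open import Function.Bundles using (_⇔_; mk⇔; Equivalence)
open import Relation.Nullary using (¬_; Dec; yes; no; does; contradiction)
open import Relation.Nullary.Decidable using (decidable-stable; ¬¬-excluded-middle; map′)
open import Relation.Binary.PropositionalEquality using (_≡_; _≢_; refl; sym; trans; cong; cong₂; subst)
open import Relation.Binary.Construct.Closure.ReflexiveTransitive using (Star; ε; _◅_; _◅◅_; gmap)

-- Existence of a walk of given length is not decided, so a minimum is available only under a double
-- negation. Later goals are negations or decidable equalities of literals, where this suffices.
¬¬-least : (P : ℕ → Set) → ∀ {n} → P n → ¬ ¬ (∃ λ m → P m × (∀ j → P j → m ≤ j))
¬¬-least P {n} Pn no-least = <-rec (λ n → ¬ P n)
  (λ n rec Pn → no-least (n , Pn , λ j Pj → ≮⇒≥ (λ j<n → rec j<n Pj))) n Pn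

-- Walks in a digraph.

module Walks {A : Set} {E : A → A → Set} where

  private variable
    x y z u v d d′ : A

  len : Star E x y → ℕ
  len ε       = 0
  len (_ ◅ w) = suc (len w)

  -- Arcs are compared by their endpoints, so walks can be reflected or mapped without tracking
  -- proofs of `E`.
  On : A → A → Star E x y → Set
  On u v ε = ⊥
  On u v (_◅_ {x} {y} _ w) = (x ≡ u × y ≡ v) ⊎ On u v w

  -- The second vertex of a walk; `lastOr` is the last but one. The default for the empty walk lets
  -- the laws for concatenation hold without side conditions.
  firstOr : A → Star E x y → A
  firstOr d ε = d
  firstOr d (_◅_ {j = y} _ _) = y

  lastOr : A → Star E x y → A
  lastOr d ε = d
  lastOr d (_◅_ {x} _ w) = lastOr x w

  len-◅◅ : (w : Star E x y) (w′ : Star E y z) → len (w ◅◅ w′) ≡ len w + len w′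
  len-◅◅ ε       w′ = refl
  len-◅◅ (_ ◅ w) w′ = cong suc (len-◅◅ w w′)

  len>0 : x ≢ y → (w : Star E x y) → 0 < len w
  len>0 x≢y ε       = contradiction refl x≢y
  len>0 x≢y (_ ◅ w) = s≤s z≤n

  firstOr-◅◅ : (w : Star E x y) (w′ : Star E y z) → firstOr d (w ◅◅ w′) ≡ firstOr (firstOr d w′) w
  firstOr-◅◅ ε       w′ = refl
  firstOr-◅◅ (_ ◅ w) w′ = refl

  lastOr-◅◅ : (w : Star E x y) (w′ : Star E y z) → lastOr d (w ◅◅ w′) ≡ lastOr (lastOr d w) w′
  lastOr-◅◅ ε       w′ = refl
  lastOr-◅◅ (_ ◅ w) w′ = lastOr-◅◅ w w′

  firstOr-default : x ≢ y → (w : Star E x y) → firstOr d w ≡ firstOr d′ w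
  firstOr-default x≢y ε       = contradiction refl x≢y
  firstOr-default x≢y (_ ◅ w) = refl

  lastOr-default : x ≢ y → (w : Star E x y) → lastOr d w ≡ lastOr d′ w
  lastOr-default x≢y ε       = contradiction refl x≢y
  lastOr-default x≢y (_ ◅ w) = refl

  first-arc : x ≢ y → (w : Star E x y) → E x (firstOr d w)
  first-arc x≢y ε       = contradiction refl x≢y
  first-arc x≢y (e ◅ w) = e

  unsnoc : x ≢ y → (w : Star E x y) →
           ∃ λ u → Σ[ w′ ∈ Star E x u ] E u y × len w ≡ suc (len w′)
  unsnoc x≢y ε       = contradiction refl x≢y
  unsnoc x≢y (e ◅ w) = go e w
    where
    go : E x y → (w : Star E y z) → ∃ λ u → Σ[ w′ ∈ Star E x u ] E u z × suc (len w) ≡ suc (len w′)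
    go e ε        = _ , ε , e , refl
    go e (e′ ◅ w) = let u , w′ , e″ , eq = go e′ w in u , e ◅ w′ , e″ , cong suc eq

  split : (w : Star E x y) → On u v w →
          Σ[ w₁ ∈ Star E x u ] E u v × (Σ[ w₂ ∈ Star E v y ] len w₁ + suc (len w₂) ≡ len w)
  split (e ◅ w) (inj₁ (refl , refl)) = ε , e , w , refl
  split (e ◅ w) (inj₂ o) = let w₁ , e′ , w₂ , eq = split w o in e ◅ w₁ , e′ , w₂ , cong suc eq

  prefix : (w : Star E x y) → On u v w → Σ[ w′ ∈ Star E x u ] len w′ < len w
  prefix w o = let w₁ , _ , w₂ , eq = split w o in
    w₁ , subst (len w₁ <_) eq (m<m+n (len w₁) (s≤s z≤n))

  suffix : (w : Star E x y) → On u v w → Σ[ w′ ∈ Star E v y ] len w′ < len w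
  suffix w o = let w₁ , _ , w₂ , eq = split w o in
    w₂ , subst (len w₂ <_) eq (m≤n+m (suc (len w₂)) (len w₁))

  On⇒E : (w : Star E x y) → On u v w → E u v
  On⇒E w o = proj₁ (proj₂ (split w o))

  visit : (w : Star E x y) → On u v w →
          Σ[ w₁ ∈ Star E x v ] Σ[ w₂ ∈ Star E v y ] len w₁ + len w₂ ≡ len w
  visit (e ◅ w) (inj₁ (refl , refl)) = e ◅ ε , w , refl
  visit (e ◅ w) (inj₂ o) = let w₁ , w₂ , eq = visit w o in e ◅ w₁ , w₂ , cong suc eq

  visit-source : (w : Star E x y) → On u v w →
          Σ[ w₁ ∈ Star E x u ] Σ[ w₂ ∈ Star E u y ] len w₁ + len w₂ ≡ len w
  visit-source w o = let w₁ , e , w₂ , eq = split w o in w₁ , e ◅ w₂ , eq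

  On-◅◅ : (w : Star E x y) (w′ : Star E y z) → On u v (w ◅◅ w′) → On u v w ⊎ On u v w′
  On-◅◅ ε       w′ o        = inj₂ o
  On-◅◅ (_ ◅ w) w′ (inj₁ p) = inj₁ (inj₁ p)
  On-◅◅ (_ ◅ w) w′ (inj₂ o) = Sum.map₁ inj₂ (On-◅◅ w w′ o)

  -- If the arc occurs after the first step, the walk returns to `x`, and cutting out that detour
  -- shortens it.
  On-start : (w : Star E x y) → On x v w → v ≡ firstOr d w ⊎ (Σ[ w′ ∈ Star E x y ] len w′ < len w)
  On-start (e ◅ w) (inj₁ (_ , refl)) = inj₁ refl
  On-start (e ◅ w) (inj₂ o) = let w′ , lt = suffix w o in inj₂ (On⇒E w o ◅ w′ , s≤s lt)

  On-end : (w : Star E x y) → On u y w → u ≡ lastOr d w ⊎ (Σ[ w′ ∈ Star E x y ] len w′ < len w)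
  On-end (e ◅ ε)      (inj₁ (refl , refl)) = inj₁ refl
  On-end (e ◅ e′ ◅ w) (inj₁ (refl , refl)) = inj₂ (e ◅ ε , s≤s (s≤s z≤n))
  On-end (e ◅ w)      (inj₂ o) = Sum.map₂ (λ (w′ , lt) → e ◅ w′ , s≤s lt) (On-end w o)

  -- Skew symmetries and shortest closed walks.

  Tri : A → A → A → ℕ → Set
  Tri x y z n = Σ[ p ∈ Star E x y ] Σ[ q ∈ Star E y z ] Σ[ r ∈ Star E z x ] len p + len q + len r ≡ n

  Closed≥ : A → A → ℕ → Set
  Closed≥ x y n = (p : Star E x y) (q : Star E y x) → n ≤ len p + len q

  -- A skew symmetry σ is minimal if every closed walk through some x and σ x
  -- meets every orbit {(u , v) , (σ v , σ u)} of arcs.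
  record MinimalSkew (σ : A → A) : Set where
    field
      involutive : ∀ x → σ (σ x) ≡ x
      reverses   : E u v → E (σ v) (σ u)
      σx≢x       : ∀ x → σ x ≢ x
      covers     : y ≡ σ x → (p : Star E x y) (q : Star E y x) → E u v →
                   (On u v p ⊎ On u v q) ⊎ (On (σ v) (σ u) p ⊎ On (σ v) (σ u) q)

    x≢σx : ∀ x → x ≢ σ x
    x≢σx x eq = σx≢x x (sym eq)

    -- The mirror image of a walk. Its ends are given up to equality because `σ (σ x)` equals `x`
    -- only propositionally.
    rev : ∀ {x′ y′} → Star E x y → x′ ≡ σ x → y′ ≡ σ y → Star E y′ x′
    rev ε       refl refl = ε
    rev (e ◅ w) refl q    = rev w refl q ◅◅ (reverses e ◅ ε)

    len-rev : ∀ {x′ y′} (w : Star E x y) (p : x′ ≡ σ x) (q : y′ ≡ σ y) → len (rev w p q) ≡ len w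
    len-rev ε       refl refl = refl
    len-rev (e ◅ w) refl q    = trans (len-◅◅ (rev w refl q) _)
      (trans (cong (_+ 1) (len-rev w refl q)) (+-comm (len w) 1))

    firstOr-rev : ∀ {x′ y′} (w : Star E x y) (p : x′ ≡ σ x) (q : y′ ≡ σ y) →
                  firstOr (σ d) (rev w p q) ≡ σ (lastOr d w)
    firstOr-rev ε       refl refl = refl
    firstOr-rev (e ◅ w) refl q    = trans (firstOr-◅◅ (rev w refl q) _) (firstOr-rev w refl q)

    On-rev : ∀ {x′ y′} (w : Star E x y) (p : x′ ≡ σ x) (q : y′ ≡ σ y) →
             On u v (rev w p q) → On (σ v) (σ u) w
    On-rev ε       refl refl ()
    On-rev {u = u} (e ◅ w) refl q o with On-◅◅ (rev w refl q) (reverses e ◅ ε) o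
    ... | inj₁ o′ = inj₂ (On-rev w refl q o′)
    ... | inj₂ (inj₁ (refl , refl)) = inj₁ (sym (involutive _) , sym (involutive _))

    -- The closed walk traverses the arc into `y` or its mirror image, which leaves `σ y`. In the
    -- second case the leg meeting `σ y` is reflected: this keeps its ends and length, and it now
    -- visits `y`.
    pass-through : (p : Star E x (σ x)) (q : Star E (σ x) x) → E u y →
                   Tri x y (σ x) (len p + len q) ⊎ Tri x (σ x) y (len p + len q)
    pass-through {x = x} {y = y} p q e with covers refl p q e
    ... | inj₁ (inj₁ o) = let p₁ , p₂ , eq = visit p o in
          inj₁ (p₁ , p₂ , q , cong (_+ len q) eq)
    ... | inj₁ (inj₂ o) = let q₁ , q₂ , eq = visit q o in
          inj₂ (p , q₁ , q₂ , trans (+-assoc (len p) _ _) (cong (len p +_) eq))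
    ... | inj₂ (inj₁ o) = let
            p₁ , p₂ , eq = visit-source p o
            y≡  = sym (involutive y)
            x≡  = sym (involutive x)
          in inj₁ (rev p₂ y≡ x≡ , rev p₁ refl y≡ , q , cong (_+ len q)
               (trans (cong₂ _+_ (len-rev p₂ y≡ x≡) (len-rev p₁ refl y≡))
                      (trans (+-comm (len p₂) _) eq)))
    ... | inj₂ (inj₂ o) = let
            q₁ , q₂ , eq = visit-source q o
            y≡  = sym (involutive y)
            x≡  = sym (involutive x)
          in inj₂ (p , rev q₂ y≡ refl , rev q₁ x≡ y≡ ,
               trans (+-assoc (len p) _ _) (cong (len p +_)
               (trans (cong₂ _+_ (len-rev q₂ y≡ refl) (len-rev q₁ x≡ y≡))
                      (trans (+-comm (len q₂) _) eq))))

    -- A shortest closed walk through x and σ x leaves x once and enters σ x once.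
    out-neighbours : (p : Star E x (σ x)) (q : Star E (σ x) x) → Closed≥ x (σ x) (len p + len q) →
                     E x v → v ≡ firstOr d p ⊎ v ≡ σ (lastOr d′ p)
    out-neighbours {x = x} {v = v} p q shortest e = [ start , end ]′ (covers refl p q e)
      where
      no-shorter-p : ¬ (Σ[ p′ ∈ Star E x (σ x) ] len p′ < len p)
      no-shorter-p (p′ , lt) = <⇒≱ (+-monoˡ-< (len q) lt) (shortest p′ q)
      no-shorter-q : ¬ (Σ[ q′ ∈ Star E (σ x) x ] len q′ < len q)
      no-shorter-q (q′ , lt) = <⇒≱ (+-monoʳ-< (len p) lt) (shortest p q′)
      start : On x v p ⊎ On x v q → _
      start (inj₁ o) = [ inj₁ , (λ s → contradiction s no-shorter-p) ]′ (On-start p o)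
      start (inj₂ o) = contradiction (prefix q o) no-shorter-q
      end : On (σ v) (σ x) p ⊎ On (σ v) (σ x) q → _
      end (inj₁ o) = [ (λ eq → inj₂ (trans (sym (involutive v)) (cong σ eq)))
                     , (λ s → contradiction s no-shorter-p) ]′ (On-end p o)
      end (inj₂ o) = contradiction (suffix q o) no-shorter-q

  -- Two minimal skew symmetries that differ at a vertex.

  open MinimalSkew

  module _ {σ σ′ : A → A} (S : MinimalSkew σ) (S′ : MinimalSkew σ′) where

    -- One closed walk is shortest for both symmetries and visits `σ′ x` before `σ x`. The other
    -- order of visit is handled by exchanging `σ` and `σ′`.
    record Config (x : A) : Set where
      field
        n         : ℕ
        triangle  : Tri x (σ′ x) (σ x) n
        shortest  : Closed≥ x (σ x) n
        shortest′ : Closed≥ x (σ′ x) n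

    open Config

    -- Reversing the part x → σ′ x of the triangle by σ′ gives another shortest closed
    -- walk; comparing what out-neighbours says about the two leaves only one out-arc.
    config⇒out-unique : σ x ≢ σ′ x → Config x → E x u → E x v → u ≡ v
    config⇒out-unique {x = x} σx≢σ′x c = λ eu ev → trans (only-α eu) (sym (only-α ev))
      where
      p = proj₁ (triangle c)
      q = proj₁ (proj₂ (triangle c))
      r = proj₁ (proj₂ (proj₂ (triangle c)))
      total = proj₂ (proj₂ (proj₂ (triangle c)))
      p̃ : Star E x (σ′ x)
      p̃ = rev S′ p refl (sym (involutive S′ x))
      -- `α` and `γ` are the second vertices of `p` and `p̃`; `β` mirrors the vertex before `σ x` on
      -- `q`. The defaults `σ′ x` and `x` correspond under `σ′`, as `firstOr-rev` requires.
      α β γ : A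
      α = firstOr (σ′ x) p
      β = σ (lastOr x q)
      γ = σ′ (lastOr x p)
      closed : (s : Star E x (σ′ x)) → len s ≡ len p → len (s ◅◅ q) + len r ≡ n c
      closed s eq = trans (cong (_+ len r) (trans (len-◅◅ s q) (cong (_+ len q) eq))) total
      bounded : (s : Star E x (σ′ x)) → len s ≡ len p → E x v → v ≡ firstOr (σ′ x) s ⊎ v ≡ β
      bounded s eq e with out-neighbours S {d = x} {d′ = x} (s ◅◅ q) r
                            (λ a b → subst (_≤ len a + len b) (sym (closed s eq)) (shortest c a b)) e
      ... | inj₁ v≡ = inj₁ (trans v≡ (trans (firstOr-◅◅ s q) (firstOr-default (x≢σx S′ x) s)))
      ... | inj₂ v≡ = inj₂ (trans v≡ (cong σ (trans (lastOr-◅◅ s q)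
                        (lastOr-default (λ eq → σx≢σ′x (sym eq)) q))))
      α-or-β : E x v → v ≡ α ⊎ v ≡ β
      α-or-β = bounded p refl
      γ-or-β : E x v → v ≡ γ ⊎ v ≡ β
      γ-or-β e = Sum.map₁ (λ v≡ → trans v≡ (firstOr-rev S′ p refl _))
                   (bounded p̃ (len-rev S′ p refl _) e)
      α-or-γ : E x v → v ≡ α ⊎ v ≡ γ
      α-or-γ = out-neighbours S′ p (q ◅◅ r)
        (λ a b → subst (_≤ len a + len b)
          (sym (trans (cong (len p +_) (len-◅◅ q r)) (trans (sym (+-assoc (len p) _ _)) total)))
          (shortest′ c a b))
      only-α : E x v → v ≡ α
      -- `α` is itself an out-neighbour, so it equals `γ` or `β`, and one of the remaining
      -- alternatives collapses to `α`.
      only-α e with γ-or-β (first-arc (x≢σx S′ x) p)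
      ... | inj₁ α≡γ = [ id , (λ eq → trans eq (sym α≡γ)) ]′ (α-or-γ e)
      ... | inj₂ α≡β = [ id , (λ eq → trans eq (sym α≡β)) ]′ (α-or-β e)

    -- If σ z ≡ σ′ z, the walk into σ′ x could step from σ z to σ x directly.
    config⇒successor-bad : σ x ≢ σ′ x → Config x → E x z → σ z ≢ σ′ z
    config⇒successor-bad {x = x} {z = z} σx≢σ′x c e σz≡σ′z =
      let p , q , r , total = triangle c
          l , p₀ , l→σ′x , len-p = unsnoc (x≢σx S′ x) p
          x→σ′l = subst (λ t → E t (σ′ l)) (involutive S′ x) (reverses S′ l→σ′x)
          z≡σ′l = config⇒out-unique σx≢σ′x c e x→σ′l
          l≡σz  = trans (sym (involutive S′ l)) (trans (cong σ′ (sym z≡σ′l)) (sym σz≡σ′z))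
          -- `p′` is as long as `p` but ends at `σ x`, so the nonempty leg `q` is saved.
          p′ = p₀ ◅◅ (subst (λ t → E t (σ x)) (sym l≡σz) (reverses S e) ◅ ε)
          len-p′ = trans (len-◅◅ p₀ _) (trans (+-comm (len p₀) 1) (sym len-p))
          n≤ = subst (λ t → n c ≤ t + len r) len-p′ (shortest c p′ r)
          n> = subst (len p + len r <_) total (+-monoˡ-< (len r)
                 (m<m+n (len p) (len>0 (λ eq → σx≢σ′x (sym eq)) q)))
      in <⇒≱ n> n≤

  -- Strongly connected digraphs.

  module _ {σ : A → A} (S : MinimalSkew σ) {V : A → Set} (V-source : ∀ {u v} → E u v → V u)
           (V-target : ∀ {u v} → E u v → V v)
           (connected : ∀ {x} → V x → ¬ ¬ (Star E x (σ x) × Star E (σ x) x)) where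

    arc-into : V x → ¬ ¬ (∃ λ u → E u x)
    arc-into {x = x} Vx k = connected Vx λ (_ , q) →
      let u , _ , e , _ = unsnoc (σx≢x S x) q in k (u , e)

    -- Some arc enters `y`, so a closed walk through `x` and `σ x` can be made to visit `y`.
    reachable : V x → V y → ¬ ¬ Star E x y
    reachable Vx Vy k = arc-into Vy λ (_ , e) → connected Vx λ (p , q) →
      [ (λ (p , _) → k p) , (λ (p , q , _) → k (p ◅◅ q)) ]′ (pass-through S p q e)

    -- Say `σ b` is at least as near to `a` as `σ c`. A shortest walk from `a` to `σ b`, the arc to
    -- `b`, the mirrored walk to `σ a` and the arc to `a` form a closed walk. It misses the arc from
    -- `σ c` to `c`, which is its own mirror image, against `covers`.
    at-most-two-loops : ∀ {a b c} → E (σ a) a → E (σ b) b → E (σ c) c →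
                        a ≢ b → a ≢ c → b ≢ c → ⊥
    at-most-two-loops {a} {b} {c} ea eb ec a≢b a≢c b≢c =
      reachable (V-target ea) (V-source eb) λ w →
      ¬¬-least (λ n → Near b n ⊎ Near c n) (inj₁ (w , refl)) λ where
        (_ , inj₁ (w , refl) , least) → nearest eb ec a≢c b≢c w
          (λ w′ → least _ (inj₂ (w′ , refl)))
        (_ , inj₂ (w , refl) , least) → nearest ec eb a≢b (λ c≡b → b≢c (sym c≡b)) w
          (λ w′ → least _ (inj₁ (w′ , refl)))
      where
      Near : A → ℕ → Set
      Near b n = Σ[ w ∈ Star E a (σ b) ] len w ≡ n
      nearest : ∀ {b c} → E (σ b) b → E (σ c) c → a ≢ c → b ≢ c → (w : Star E a (σ b)) →
                ((w′ : Star E a (σ c)) → len w ≤ len w′) → ⊥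
      nearest {b} {c} eb ec a≢c b≢c w least = [ uncovered , uncovered′ ]′ (covers S refl loop (ea ◅ ε) ec)
        where
        w̄ : Star E b (σ a)
        w̄ = rev S w refl (sym (involutive S b))
        loop : Star E a (σ a)
        loop = w ◅◅ (eb ◅ w̄)
        not-on-w : ¬ On (σ c) c w
        not-on-w o = let w′ , lt = prefix w o in <⇒≱ lt (least w′)
        uncovered : ¬ (On (σ c) c loop ⊎ On (σ c) c (ea ◅ ε))
        uncovered (inj₂ (inj₁ (_ , a≡c))) = a≢c a≡c
        uncovered (inj₁ o) with On-◅◅ w (eb ◅ w̄) o
        ... | inj₁ o′ = not-on-w o′
        ... | inj₂ (inj₁ (_ , b≡c)) = b≢c b≡c
        ... | inj₂ (inj₂ o′) = not-on-w (subst (λ t → On (σ c) t w) (involutive S c)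
                                 (On-rev S w refl (sym (involutive S b)) o′))
        uncovered′ : ¬ (On (σ c) (σ (σ c)) loop ⊎ On (σ c) (σ (σ c)) (ea ◅ ε))
        uncovered′ = subst (λ t → ¬ (On (σ c) t loop ⊎ On (σ c) t (ea ◅ ε)))
                       (sym (involutive S c)) uncovered

    module _ {σ′ : A → A} (S′ : MinimalSkew σ′) where

      -- A shortest closed walk through `x` and `σ x` can be made to visit `σ′ x` at no cost.
      -- Conversely every closed walk through `x` and `σ′ x` can be made to visit `σ x`, so both
      -- minima agree. The disjuncts are the two orders of visit.
      config : V x → ¬ ¬ (Config S S′ x ⊎ Config S′ S x)
      config {x = x} Vx k = connected Vx λ (p , q) →
        ¬¬-least (λ n → Σ[ p ∈ Star E x (σ x) ] Σ[ q ∈ Star E (σ x) x ] len p + len q ≡ n)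
          (p , q , refl) λ where
          (n , (p , q , refl) , least) →
            -- The mirror images of this arc enter `σ x` and `σ′ x`, as `pass-through` demands.
            let x→z = first-arc {d = x} (x≢σx S x) p
                short : Closed≥ x (σ x) n
                short = λ a b → least _ (a , b , refl)
                tri-bound : ∀ {m} → Tri x (σ x) (σ′ x) m ⊎ Tri x (σ′ x) (σ x) m → n ≤ m
                tri-bound = λ where
                  (inj₁ (a , b , c , eq)) → subst (n ≤_)
                    (trans (cong (len a +_) (len-◅◅ b c)) (trans (sym (+-assoc (len a) _ _)) eq))
                    (short a (b ◅◅ c))
                  (inj₂ (a , b , c , eq)) → subst (n ≤_)
                    (trans (cong (_+ len c) (len-◅◅ a b)) eq) (short (a ◅◅ b) c)
                short′ : Closed≥ x (σ′ x) n
                short′ = λ a b → tri-bound (pass-through S′ a b (reverses S x→z))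
            in k (Sum.map
                 (λ t → record { n = n ; triangle = t ; shortest = short ; shortest′ = short′ })
                 (λ t → record { n = n ; triangle = t ; shortest = short′ ; shortest′ = short })
                 (pass-through S p q (reverses S′ x→z)))

      bad-out-unique : V x → σ x ≢ σ′ x → E x u → E x v → ¬ ¬ (u ≡ v)
      bad-out-unique Vx bad eu ev k = config Vx λ where
        (inj₁ c) → k (config⇒out-unique S S′ bad c eu ev)
        (inj₂ c) → k (config⇒out-unique S′ S (λ eq → bad (sym eq)) c eu ev)

      bad-successor : σ x ≢ σ′ x → E x z → σ z ≢ σ′ z
      bad-successor bad e eq = config (V-source e) λ where
        (inj₁ c) → config⇒successor-bad S S′ bad c e eq
        (inj₂ c) → config⇒successor-bad S′ S (λ eq′ → bad (sym eq′)) c e (sym eq)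

      bad-reachable : σ x ≢ σ′ x → Star E x z → σ z ≢ σ′ z
      bad-reachable bad ε       = bad
      bad-reachable bad (e ◅ w) = bad-reachable (bad-successor bad e) w

      -- Disagreement at one vertex spreads along arcs to every vertex and forces a single
      -- out-neighbour there.
      bad⇒functional : V x → σ x ≢ σ′ x → E z u → E z v → ¬ ¬ (u ≡ v)
      bad⇒functional Vx bad eu ev k = reachable Vx (V-source eu) λ w →
        bad-out-unique (V-source eu) (bad-reachable bad w) eu ev k

open Walks
open MinimalSkew

private variable
  F F′ : CNF
  C D : Clause
  k : ℕ
  l p q u v u′ v′ : Lit

-- Literals, clauses and their arcs.

_≟L_ : (p q : Lit) → Dec (p ≡ q)
pos m ≟L pos n = map′ (cong pos) (λ { refl → refl }) (m ≟ n)
neg m ≟L neg n = map′ (cong neg) (λ { refl → refl }) (m ≟ n)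
pos m ≟L neg n = no λ ()
neg m ≟L pos n = no λ ()

compl-involutive : ∀ p → compl (compl p) ≡ p
compl-involutive (pos _) = refl
compl-involutive (neg _) = refl

compl≢ : ∀ p → compl p ≢ p
compl≢ (pos _) ()
compl≢ (neg _) ()

compl-swap : u ≡ compl p → compl u ≡ p
compl-swap {p = p} refl = compl-involutive p

var-compl : ∀ p → var (compl p) ≡ var p
var-compl (pos _) = refl
var-compl (neg _) = refl

LitOf-compl : ∀ p → LitOf F p → LitOf F (compl p)
LitOf-compl {F} p = subst (_∈ vars F) (sym (var-compl p))

same-var : ∀ p q → var p ≡ var q → p ≡ q ⊎ p ≡ compl q
same-var (pos _) (pos _) refl = inj₁ refl
same-var (pos _) (neg _) refl = inj₂ refl
same-var (neg _) (pos _) refl = inj₂ refl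
same-var (neg _) (neg _) refl = inj₁ refl

∈⇒LitOf : C ∈ F → l ∈ C → LitOf F l
∈⇒LitOf C∈F l∈C = ∈-deduplicate⁺ _≟_ (∈-map⁺ var (∈-concat⁺′ l∈C C∈F))

LitOf⇒∈ : LitOf F p → ∃₂ λ l C → l ∈ C × C ∈ F × (p ≡ l ⊎ p ≡ compl l)
LitOf⇒∈ {F} {p} Vp =
  let l , l∈ , eq = ∈-map⁻ var (∈-deduplicate⁻ _≟_ (map var (concat F)) Vp)
      C , l∈C , C∈F = ∈-concat⁻′ F l∈
  in l , C , l∈C , C∈F , same-var p l eq

Clause₂ : Clause → Set
Clause₂ C = WFClause C × length C ≤ 2

distinct : Unique (p ∷ q ∷ []) → p ≢ q
distinct ((p≢q ∷ []) ∷ _) = p≢q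

-- This treats both clause sizes alike: a unit clause is the case `compl u ≡ v`.
ArcFrom⇒∈⇔ : ArcFrom C u v → ∀ l → l ∈ C ⇔ (l ≡ compl u ⊎ l ≡ v)
ArcFrom⇒∈⇔ {x ∷ []} (refl , refl) l = mk⇔
  (λ { (here refl) → inj₂ refl })
  (λ { (inj₁ refl) → here (compl-involutive x) ; (inj₂ refl) → here refl })
ArcFrom⇒∈⇔ {x ∷ y ∷ []} (inj₁ (refl , refl)) l = mk⇔
  (λ { (here refl) → inj₁ (sym (compl-involutive x)) ; (there (here refl)) → inj₂ refl })
  (λ { (inj₁ refl) → here (compl-involutive x) ; (inj₂ refl) → there (here refl) })
ArcFrom⇒∈⇔ {x ∷ y ∷ []} (inj₂ (refl , refl)) l = mk⇔
  (λ { (here refl) → inj₂ refl ; (there (here refl)) → inj₁ (sym (compl-involutive y)) })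
  (λ { (inj₁ refl) → there (here (compl-involutive y)) ; (inj₂ refl) → here refl })

-- If `p` and `q` coincide, the clause must be a unit, since its entries are distinct.
∈⇔⇒ArcFrom : Clause₂ C → p ∈ C → q ∈ C → (∀ l → l ∈ C → l ≡ p ⊎ l ≡ q) → ArcFrom C (compl p) q
∈⇔⇒ArcFrom {_ ∷ _ ∷ _ ∷ _} (_ , s≤s (s≤s ())) _ _ _
∈⇔⇒ArcFrom {x ∷ []} _ (here refl) (here refl) _ = refl , refl
∈⇔⇒ArcFrom {x ∷ y ∷ []} _ (here refl) (there (here refl)) _ = inj₁ (refl , refl)
∈⇔⇒ArcFrom {x ∷ y ∷ []} _ (there (here refl)) (here refl) _ = inj₂ (refl , refl)
∈⇔⇒ArcFrom {x ∷ y ∷ []} ((x≢y , _) , _) (here refl) (here refl) only =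
  contradiction (sym ([ id , id ]′ (only y (there (here refl))))) (distinct x≢y)
∈⇔⇒ArcFrom {x ∷ y ∷ []} ((x≢y , _) , _) (there (here refl)) (there (here refl)) only =
  contradiction ([ id , id ]′ (only x (here refl))) (distinct x≢y)

∈⇒ArcFrom : Clause₂ C → p ∈ C → ∃ λ q → q ∈ C × ArcFrom C (compl p) q
∈⇒ArcFrom {_ ∷ _ ∷ _ ∷ _} (_ , s≤s (s≤s ())) _
∈⇒ArcFrom {x ∷ []}     _ (here refl)         = x , here refl , refl , refl
∈⇒ArcFrom {x ∷ y ∷ []} _ (here refl)         = y , there (here refl) , inj₁ (refl , refl)
∈⇒ArcFrom {x ∷ y ∷ []} _ (there (here refl)) = x , here refl , inj₂ (refl , refl)

ArcFrom-target : ∀ C → ArcFrom C u v → v ∈ C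
ArcFrom-target {v = v} C a = Equivalence.from (ArcFrom⇒∈⇔ {C} a v) (inj₂ refl)

ArcFrom-source : ∀ C → ArcFrom C u v → compl u ∈ C
ArcFrom-source {u = u} C a = Equivalence.from (ArcFrom⇒∈⇔ {C} a (compl u)) (inj₁ refl)

ArcFrom-reverse : ∀ C → ArcFrom C u v → ArcFrom C (compl v) (compl u)
ArcFrom-reverse (x ∷ [])     (refl , refl)        = refl , compl-involutive x
ArcFrom-reverse (x ∷ y ∷ []) (inj₁ (refl , refl)) = inj₂ (refl , compl-involutive x)
ArcFrom-reverse (x ∷ y ∷ []) (inj₂ (refl , refl)) = inj₁ (refl , compl-involutive y)

-- The arcs of a clause form one orbit under mirroring, so using a clause means using one of two
-- mirrored arcs.
ArcFrom-orbit : ∀ C → ArcFrom C u v → ArcFrom C u′ v′ →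
                (u′ ≡ u × v′ ≡ v) ⊎ (u′ ≡ compl v × v′ ≡ compl u)
ArcFrom-orbit (x ∷ [])     (refl , refl)        (refl , refl)        = inj₁ (refl , refl)
ArcFrom-orbit (x ∷ y ∷ []) (inj₁ (refl , refl)) (inj₁ (refl , refl)) = inj₁ (refl , refl)
ArcFrom-orbit (x ∷ y ∷ []) (inj₁ (refl , refl)) (inj₂ (refl , refl)) = inj₂ (refl , sym (compl-involutive x))
ArcFrom-orbit (x ∷ y ∷ []) (inj₂ (refl , refl)) (inj₁ (refl , refl)) = inj₂ (refl , sym (compl-involutive y))
ArcFrom-orbit (x ∷ y ∷ []) (inj₂ (refl , refl)) (inj₂ (refl , refl)) = inj₁ (refl , refl)

Arc-reverse : Arc F u v → Arc F (compl v) (compl u)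
Arc-reverse a = let C , C∈F , a′ = find a in lose C∈F (ArcFrom-reverse C a′)

Arc-target : Arc F u v → LitOf F v
Arc-target a = let C , C∈F , a′ = find a in ∈⇒LitOf C∈F (ArcFrom-target C a′)

Arc-source : Arc F u v → LitOf F u
Arc-source {F} {u} a = subst (_∈ vars F) (var-compl u) (Arc-target {F} (Arc-reverse a))

-- Assignments and walks in minimally unsatisfiable formulas.

module _ {A : Set} {P : A → Set} where

  Any-removeAt : ∀ {xs} i → Any P xs → P (lookup xs i) ⊎ Any P (removeAt xs i)
  Any-removeAt zero    (here px) = inj₁ px
  Any-removeAt zero    (there a) = inj₂ a
  Any-removeAt (suc i) (here px) = inj₂ (here px)
  Any-removeAt (suc i) (there a) = Sum.map₂ there (Any-removeAt i a)

  All-removeAt⁻ : ∀ {xs} i → P (lookup xs i) → All P (removeAt xs i) → All P xs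
  All-removeAt⁻ {_ ∷ _} zero    px ps        = px ∷ ps
  All-removeAt⁻ {_ ∷ _} (suc i) px (py ∷ ps) = py ∷ All-removeAt⁻ i px ps

lookup-at : ∀ {A : Set} {P : A → Set} {xs} (a : Any P xs) → P (lookup xs (index a))
lookup-at (here px) = px
lookup-at (there a) = lookup-at a

SatLit-compl : ∀ {α} p → SatLit α p → ¬ SatLit α (compl p)
SatLit-compl {α} (pos v) t f with α v
SatLit-compl (pos v) refl () | true
SatLit-compl {α} (neg v) f t with α v
SatLit-compl (neg v) refl () | false

SatLit-total : ∀ α p → SatLit α p ⊎ SatLit α (compl p)
SatLit-total α (pos v) with α v
... | true  = inj₁ refl
... | false = inj₂ refl
SatLit-total α (neg v) with α v
... | true  = inj₂ refl
... | false = inj₁ refl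

SatClause-arc : ∀ {α} C → ArcFrom C u v → SatClause α C → SatLit α u → SatLit α v
SatClause-arc {u = u} {α = α} C a s su with find s
... | l , l∈C , sl with Equivalence.to (ArcFrom⇒∈⇔ {C} a l) l∈C
...   | inj₁ refl = contradiction sl (SatLit-compl {α} u su)
...   | inj₂ refl = sl

-- A walk avoiding the removed clause propagates truth, so a contradictory closed walk must use it.
covers-compl : MinUnsat F → ∀ {x y} → y ≡ compl x → (p : Star (Arc F) x y) (q : Star (Arc F) y x) →
               Arc F u v → (On u v p ⊎ On u v q) ⊎ (On (compl v) (compl u) p ⊎ On (compl v) (compl u) q)
covers-compl {F} {u} {v} (_ , min) {x} refl p q a = cover (propagate p) (propagate q)
  where
  i = index a
  -- `α` satisfies all clauses other than the one contributing `a`.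
  α = proj₁ (min i)
  Hit : ∀ {x y} → Star (Arc F) x y → Set
  Hit w = On u v w ⊎ On (compl v) (compl u) w
  propagate : ∀ {x y} (w : Star (Arc F) x y) → Hit w ⊎ (SatLit α x → SatLit α y)
  propagate ε = inj₂ id
  propagate (e ◅ w) with Any-removeAt i e | propagate w
  ... | _       | inj₁ hit = inj₁ (Sum.map inj₂ inj₂ hit)
  ... | inj₁ e′ | inj₂ _   = inj₁ (Sum.map inj₁ inj₁ (ArcFrom-orbit (lookup F i) (lookup-at a) e′))
  ... | inj₂ e′ | inj₂ prop = inj₂ λ s →
        let D , D∈ , eD = find e′ in prop (SatClause-arc {α = α} D eD (All.lookup (proj₂ (min i)) D∈) s)
  cover : Hit p ⊎ (SatLit α x → SatLit α (compl x)) → Hit q ⊎ (SatLit α (compl x) → SatLit α x) → _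
  cover (inj₁ (inj₁ o)) _ = inj₁ (inj₁ o)
  cover (inj₁ (inj₂ o)) _ = inj₂ (inj₁ o)
  cover _ (inj₁ (inj₁ o)) = inj₁ (inj₂ o)
  cover _ (inj₁ (inj₂ o)) = inj₂ (inj₂ o)
  cover (inj₂ to) (inj₂ from) with SatLit-total α x
  ... | inj₁ s = contradiction (to s) (SatLit-compl {α} x s)
  ... | inj₂ s = contradiction s (SatLit-compl {α} x (from s))

compl-minimalSkew : MinUnsat F → MinimalSkew {E = Arc F} compl
compl-minimalSkew mu = record
  { involutive = compl-involutive
  ; reverses   = Arc-reverse
  ; σx≢x       = compl≢
  ; covers     = covers-compl mu
  }

-- Supplies decisions of reachability for the finitely many variables, under a double negation that
-- a negated goal absorbs.
¬¬-decide-all : ∀ {A : Set} (P : A → Set) xs → ¬ ¬ All (λ x → Dec (P x)) xs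
¬¬-decide-all P []       k = k []
¬¬-decide-all P (x ∷ xs) k = ¬¬-excluded-middle λ d → ¬¬-decide-all P xs λ ds → k (d ∷ ds)

-- Otherwise, making all literals reachable from l true would turn an assignment
-- satisfying F minus C into one satisfying F.
refutes-itself : Is2CNF F → MinUnsat F → C ∈ F → l ∈ C → ¬ ¬ Star (Arc F) l (compl l)
refutes-itself {F} {C} {l} (two , _) mu C∈F l∈C irrefutable =
  ¬¬-decide-all (λ n → Reach (pos n)) (vars F) λ dec⁺ →
  ¬¬-decide-all (λ n → Reach (neg n)) (vars F) λ dec⁻ →
  proj₁ mu (_ , Modify.satisfies (decide dec⁺ dec⁻))
  where
  S = compl-minimalSkew mu
  Reach : Lit → Set
  Reach = Star (Arc F) l
  i = index C∈F
  α = proj₁ (proj₂ mu i)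
  Reach⇒LitOf : Reach p → LitOf F p
  Reach⇒LitOf w = end w (∈⇒LitOf C∈F l∈C)
    where
    end : ∀ {x y} → Star (Arc F) x y → LitOf F x → LitOf F y
    end ε       Vx = Vx
    end (e ◅ w) _  = end w (Arc-target e)
  decide : All (λ n → Dec (Reach (pos n))) (vars F) → All (λ n → Dec (Reach (neg n))) (vars F) →
           ∀ p → Dec (Reach p)
  decide dec⁺ dec⁻ p with var p ∈? vars F
  decide dec⁺ dec⁻ p       | no  ¬Vp = no λ r → ¬Vp (Reach⇒LitOf r)
  decide dec⁺ dec⁻ (pos n) | yes Vp  = All.lookup dec⁺ Vp
  decide dec⁺ dec⁻ (neg n) | yes Vp  = All.lookup dec⁻ Vp
  consistent : ∀ p → Reach p → ¬ Reach (compl p)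
  -- The mirror image of `r′` leads from `p` to `compl l`, and would extend `r`.
  consistent p r r′ = irrefutable (r ◅◅ rev S r′ refl (sym (compl-involutive p)))
  module Modify (dec : ∀ p → Dec (Reach p)) where
    β : Assignment
    β n = if does (dec (pos n)) then true else if does (dec (neg n)) then false else α n
    reached : ∀ p → Reach p → SatLit β p
    reached (pos n) r with dec (pos n)
    ... | yes _ = refl
    ... | no ¬r = contradiction r ¬r
    reached (neg n) r with dec (pos n) | dec (neg n)
    ... | yes r′ | _     = contradiction r (consistent (pos n) r′)
    ... | no _   | yes _ = refl
    ... | no _   | no ¬r = contradiction r ¬r
    kept : ∀ p → ¬ Reach (compl p) → SatLit α p → SatLit β p
    kept (pos n) ¬r s with dec (pos n) | dec (neg n)
    ... | yes _ | _     = refl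
    ... | no _  | yes r = contradiction r ¬r
    ... | no _  | no _  = s
    kept (neg n) ¬r s with dec (pos n) | dec (neg n)
    ... | yes r | _     = contradiction r ¬r
    ... | no _  | yes _ = refl
    ... | no _  | no _  = s
    satisfies : SatCNF β F
    satisfies = All-removeAt⁻ i (lose (subst (l ∈_) (lookup-at C∈F) l∈C) (reached l ε))
                  (All.tabulate satisfies-other)
      where
      satisfies-other : D ∈ removeAt F i → SatClause β D
      satisfies-other {D} D∈ with find (All.lookup (proj₂ (proj₂ mu i)) D∈)
      ... | p , p∈D , s with dec (compl p)
      ...   | no ¬r = lose p∈D (kept p ¬r s)
      -- `D` gives an arc from the reachable `compl p` to some `q` in `D`, which `β` therefore makes
      -- true.
      ...   | yes r = let D∈F = ∈-removeAt⁻ i D∈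
                          q , q∈D , a = ∈⇒ArcFrom (All.lookup two D∈F) p∈D
                      in lose q∈D (reached q (r ◅◅ (lose D∈F a ◅ ε)))
        where
        ∈-removeAt⁻ : ∀ {A : Set} {xs : List A} {x} i → x ∈ removeAt xs i → x ∈ xs
        ∈-removeAt⁻ {xs = _ ∷ _} zero    x∈         = there x∈
        ∈-removeAt⁻ {xs = _ ∷ _} (suc i) (here eq)  = here eq
        ∈-removeAt⁻ {xs = _ ∷ _} (suc i) (there x∈) = there (∈-removeAt⁻ i x∈)

-- Let `l` occur in a clause with literals `l` and `q`, possibly equal. `refutes-itself` leads from
-- `l` to `compl l`; the way back runs over `q` and `compl q`, by `refutes-itself` for `q` between
-- two mirrored arcs.
LitOf-connected : Is2CNF F → MinUnsat F → LitOf F p →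
                  ¬ ¬ (Star (Arc F) p (compl p) × Star (Arc F) (compl p) p)
LitOf-connected {F} {p} f2 mu Vp k with LitOf⇒∈ {F} Vp
... | l , C , l∈C , C∈F , p≡ =
  let q , q∈C , a = ∈⇒ArcFrom (All.lookup (proj₁ f2) C∈F) l∈C
      e = lose C∈F a
      e′ = subst (Arc F (compl q)) (compl-involutive l) (Arc-reverse e)
  in refutes-itself f2 mu C∈F l∈C λ w →
     refutes-itself f2 mu C∈F q∈C λ w′ →
     let back = e ◅ (w′ ◅◅ (e′ ◅ ε)) in
     [ (λ { refl → k (w , back) })
     , (λ { refl → k (subst (Star (Arc F) (compl l)) (sym (compl-involutive l)) back
                     , subst (λ t → Star (Arc F) t (compl l)) (sym (compl-involutive l)) w) })
     ]′ p≡

-- There are at least two clauses, so removing another one would leave the empty clause in a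
-- satisfiable rest.
[]∉ : 2 ≤ k → MinUnsat F → HasDeficiency F k → ¬ ([] ∈ F)
[]∉ {F = F} 2≤k mu def = absent F (proj₂ mu) (≤-trans 2≤k (≤-trans (m≤n+m _ _) (≤-reflexive (sym def))))
  where
  falsified : [] ∈ F′ → ¬ Satisfiable F′
  falsified []∈ (α , s) with All.lookup s []∈
  ... | ()
  absent : ∀ F → (∀ i → Satisfiable (removeAt F i)) → 2 ≤ length F → ¬ ([] ∈ F)
  absent (C ∷ [])    sat (s≤s ())
  absent (C ∷ D ∷ F) sat _ (here refl) = falsified (here refl) (sat (suc zero))
  absent (C ∷ D ∷ F) sat _ (there []∈) = falsified []∈ (sat zero)

-- Counting literal occurrences and unit clauses.

Unique-⊆⇒length≤ : ∀ {A : Set} {xs ys : List A} → Unique xs → (∀ {x} → x ∈ xs → x ∈ ys) →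
                   length xs ≤ length ys
Unique-⊆⇒length≤ {xs = []} _ _ = z≤n
Unique-⊆⇒length≤ {xs = x ∷ xs} (x∉ ∷ uniq) sub with ∈-∃++ (sub (here refl))
... | ys , zs , refl = ≤-trans (s≤s (Unique-⊆⇒length≤ uniq sub′)) (≤-reflexive length-eq)
  where
  sub′ : ∀ {z} → z ∈ xs → z ∈ ys ++ zs
  sub′ z∈ with ∈-++⁻ ys (sub (there z∈))
  ... | inj₁ z∈ys         = ∈-++⁺ˡ z∈ys
  ... | inj₂ (here refl)  = contradiction refl (All.lookup x∉ z∈)
  ... | inj₂ (there z∈zs) = ∈-++⁺ʳ ys z∈zs
  length-eq : suc (length (ys ++ zs)) ≡ length (ys ++ x ∷ zs)
  length-eq = trans (cong suc (length-++ ys)) (trans (sym (+-suc (length ys) _)) (sym (length-++ ys)))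

units : CNF → List Lit
units []             = []
units ((l ∷ []) ∷ F) = l ∷ units F
units (_ ∷ F)        = units F

∈-units : ∀ F → l ∈ units F → (l ∷ []) ∈ F
∈-units ((x ∷ []) ∷ F)    (here refl) = here refl
∈-units ((x ∷ []) ∷ F)    (there l∈)  = there (∈-units F l∈)
∈-units ([] ∷ F)          l∈          = there (∈-units F l∈)
∈-units ((_ ∷ _ ∷ _) ∷ F) l∈          = there (∈-units F l∈)

≡⇒≈C : C ≡ D → C ≈C D
≡⇒≈C refl _ = mk⇔ id id

units-unique : ∀ {F} → AllPairs (λ C D → ¬ (C ≈C D)) F → Unique (units F)
units-unique [] = []
units-unique {(x ∷ []) ∷ F}    (≉ ∷ ps) =
  All.tabulate (λ l∈ x≡l → All.lookup ≉ (∈-units F l∈) (≡⇒≈C (cong (_∷ []) x≡l))) ∷ units-unique ps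
units-unique {[] ∷ F}          (_ ∷ ps) = units-unique ps
units-unique {(_ ∷ _ ∷ _) ∷ F} (_ ∷ ps) = units-unique ps

-- Every clause contributes at least two on the right: a unit counts once in each summand.
length-units : ∀ F → ¬ ([] ∈ F) → length F + length F ≤ length (concat F) + length (units F)
length-units []             _  = z≤n
length-units ([] ∷ F)       ne = contradiction (here refl) ne
length-units ((x ∷ []) ∷ F) ne = s≤s (begin
  length F + suc (length F)                   ≡⟨ +-suc _ _ ⟩
  suc (length F + length F)                   ≤⟨ s≤s (length-units F (λ []∈ → ne (there []∈))) ⟩
  suc (length (concat F) + length (units F))  ≡⟨ +-suc _ _ ⟨
  length (concat F) + suc (length (units F))  ∎)
  where open ≤-Reasoning
length-units ((x ∷ y ∷ C) ∷ F) ne = s≤s (begin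
  length F + suc (length F)                        ≡⟨ +-suc _ _ ⟩
  suc (length F + length F)                        ≤⟨ s≤s (length-units F (λ []∈ → ne (there []∈))) ⟩
  suc (length (concat F) + length (units F))       ≤⟨ s≤s (+-monoˡ-≤ _ (m≤n+m _ (length C))) ⟩
  suc (length C + length (concat F) + length (units F)) ≡⟨ cong (λ t → suc (t + length (units F))) (length-++ C) ⟨
  suc (length (C ++ concat F) + length (units F))  ∎)
  where open ≤-Reasoning

Functional : CNF → Set
Functional F = ∀ {p u v} → Arc F p u → Arc F p v → u ≡ v

-- Both clauses give an arc out of `compl l`; a common target fixes the remaining literal.
functional⇒≈C : All Clause₂ F → Functional F → C ∈ F → D ∈ F → l ∈ C → l ∈ D → C ≈C D
functional⇒≈C {F} {C} {D} two fun C∈F D∈F l∈C l∈D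
  with ∈⇒ArcFrom (All.lookup two C∈F) l∈C | ∈⇒ArcFrom (All.lookup two D∈F) l∈D
... | q , _ , a | q′ , _ , a′ with fun {v = q′} (lose C∈F a) (lose D∈F a′)
... | refl = λ m → mk⇔
      (λ m∈ → Equivalence.from (ArcFrom⇒∈⇔ {D} a′ m) (Equivalence.to (ArcFrom⇒∈⇔ {C} a m) m∈))
      (λ m∈ → Equivalence.from (ArcFrom⇒∈⇔ {C} a m) (Equivalence.to (ArcFrom⇒∈⇔ {D} a′ m) m∈))

functional⇒concat-unique : Is2CNF F → Functional F → Unique (concat F)
functional⇒concat-unique {F} (two , ≉) fun =
  concat⁺ (All.map (λ c → proj₁ (proj₁ c)) two) (pairs F id ≉)
  where
  pairs : ∀ G → (∀ {C} → C ∈ G → C ∈ F) → AllPairs (λ C D → ¬ (C ≈C D)) G → AllPairs Disjoint G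
  pairs []      _   []       = []
  pairs (C ∷ G) sub (C≉ ∷ ≉) =
    All.tabulate (λ D∈G (l∈C , l∈D) → All.lookup C≉ D∈G
      (functional⇒≈C two fun (sub (here refl)) (sub (there D∈G)) l∈C l∈D))
    ∷ pairs G (λ C∈ → sub (there C∈)) ≉

length-concat : Unique (concat F) → length (concat F) ≤ nvars F + nvars F
length-concat {F} uniq = ≤-trans (Unique-⊆⇒length≤ {ys = lits} uniq occurs) (≤-reflexive (trans
    (length-++ (map pos (vars F))) (cong₂ _+_ (length-map pos (vars F)) (length-map neg (vars F)))))
  where
  lits = map pos (vars F) ++ map neg (vars F)
  V⇒lits : ∀ p → LitOf F p → p ∈ lits
  V⇒lits (pos n) Vp = ∈-++⁺ˡ (∈-map⁺ pos Vp)
  V⇒lits (neg n) Vp = ∈-++⁺ʳ (map pos (vars F)) (∈-map⁺ neg Vp)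
  occurs : ∀ {p} → p ∈ concat F → p ∈ lits
  occurs {p} p∈ = let C , p∈C , C∈F = ∈-concat⁻′ F p∈ in V⇒lits p (∈⇒LitOf C∈F p∈C)

-- No literal would occur twice, so `2(n + k)` is at most `2n` plus the number of units. This yields
-- four units, against `at-most-two-loops`.
¬functional : 2 ≤ k → Is2CNF F → MinUnsat F → HasDeficiency F k → ¬ Functional F
¬functional {k} {F} 2≤k f2 mu def fun =
  many-units (units F) (units-unique (proj₂ f2)) id 4≤units
  where
  open ≤-Reasoning
  n = nvars F
  rearrange : ∀ n k → (n + n) + (k + k) ≡ (n + k) + (n + k)
  rearrange = solve-∀
  4≤units : 4 ≤ length (units F)
  4≤units = ≤-trans (+-mono-≤ 2≤k 2≤k) (+-cancelˡ-≤ (n + n) _ _ (begin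
    (n + n) + (k + k)                       ≡⟨ rearrange n k ⟩
    (n + k) + (n + k)                       ≡⟨ cong₂ _+_ def def ⟨
    length F + length F                     ≤⟨ length-units F ([]∉ 2≤k mu def) ⟩
    length (concat F) + length (units F)    ≤⟨ +-monoˡ-≤ _ (length-concat {F} (functional⇒concat-unique f2 fun)) ⟩
    (n + n) + length (units F)              ∎))
  loop : l ∈ units F → Arc F (compl l) l
  loop l∈ = lose (∈-units F l∈) (refl , refl)
  many-units : ∀ ls → Unique ls → (∀ {l} → l ∈ ls → l ∈ units F) → ¬ (4 ≤ length ls)
  many-units (_ ∷ [])         _ _ (s≤s ())
  many-units (_ ∷ _ ∷ [])     _ _ (s≤s (s≤s ()))
  many-units (a ∷ b ∷ c ∷ _) ((a≢b ∷ a≢c ∷ _) ∷ (b≢c ∷ _) ∷ _) sub _ =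
    at-most-two-loops (compl-minimalSkew mu) {V = LitOf F} Arc-source Arc-target (LitOf-connected f2 mu)
      (loop (sub (here refl))) (loop (sub (there (here refl)))) (loop (sub (there (there (here refl)))))
      a≢b a≢c b≢c

-- A disagreement would make the digraph functional; decidable equality of literals removes the
-- double negations.
minimalSkew-unique : 2 ≤ k → Is2CNF F → MinUnsat F → HasDeficiency F k →
                     ∀ {σ} → MinimalSkew {E = Arc F} σ → LitOf F p → compl p ≡ σ p
minimalSkew-unique {F = F} {p = p} 2≤k f2 mu def {σ} S Vp = decidable-stable (compl p ≟L σ p) λ bad →
  ¬functional 2≤k f2 mu def λ {_} {u} {v} eu ev → decidable-stable (u ≟L v)
    (bad⇒functional (compl-minimalSkew mu) {V = LitOf F} Arc-source Arc-target (LitOf-connected f2 mu) S Vp bad eu ev)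

-- Pulling complementation back along a digraph isomorphism.

On-gmap : ∀ {f : Lit → Lit} (g : ∀ {u v} → Arc F u v → Arc F′ (f u) (f v)) {x y} (w : Star (Arc F) x y) →
          On {E = Arc F′} u′ v′ (gmap f g w) → ∃₂ λ u v → On u v w × f u ≡ u′ × f v ≡ v′
On-gmap g (_ ◅ w) (inj₁ (eu , ev)) = _ , _ , inj₁ (refl , refl) , eu , ev
On-gmap g (_ ◅ w) (inj₂ o) = let u , v , o′ , eqs = On-gmap g w o in u , v , inj₂ o′ , eqs

module Transport {F F′ : CNF} (mu′ : MinUnsat F′) {f : Lit → Lit} (iso : IsDigraphIso F F′ f) where

  f-maps = proj₁ (proj₁ iso)
  f-inj  = proj₁ (proj₂ (proj₁ iso))
  f-surj = proj₂ (proj₂ (proj₁ iso))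

  arc : Arc F u v → Arc F′ (f u) (f v)
  arc = proj₁ (proj₂ iso) _ _

  arc⁻ : LitOf F u → LitOf F v → Arc F′ (f u) (f v) → Arc F u v
  arc⁻ Vu Vv a with proj₂ (proj₂ iso) _ _ a
  ... | u₀ , v₀ , a₀ , fu₀ , fv₀ with f-inj _ _ (Arc-source a₀) Vu fu₀ | f-inj _ _ (Arc-target a₀) Vv fv₀
  ... | refl | refl = a₀

  -- The pullback of complementation on F′; off the vertices of F any fixed-point-free involution would do.
  σ : Lit → Lit
  σ x with var x ∈? vars F
  ... | yes Vx = proj₁ (f-surj (compl (f x)) (LitOf-compl {F′} (f x) (f-maps x Vx)))
  ... | no _   = compl x

  σ-LitOf : LitOf F p → LitOf F (σ p)
  σ-LitOf {p} Vp with var p ∈? vars F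
  ... | yes Vx = proj₁ (proj₂ (f-surj (compl (f p)) (LitOf-compl {F′} (f p) (f-maps p Vx))))
  ... | no ¬Vp = contradiction Vp ¬Vp

  f-σ : LitOf F p → f (σ p) ≡ compl (f p)
  f-σ {p} Vp with var p ∈? vars F
  ... | yes Vx = proj₂ (proj₂ (f-surj (compl (f p)) (LitOf-compl {F′} (f p) (f-maps p Vx))))
  ... | no ¬Vp = contradiction Vp ¬Vp

  σ-off : ¬ LitOf F p → σ p ≡ compl p
  σ-off {p} ¬Vp with var p ∈? vars F
  ... | yes Vp = contradiction Vp ¬Vp
  ... | no _   = refl

  σ-involutive : ∀ p → σ (σ p) ≡ p
  σ-involutive p = case var p ∈? vars F of λ where
    (yes Vp) → f-inj _ _ (σ-LitOf (σ-LitOf Vp)) Vp (trans (f-σ (σ-LitOf Vp)) (compl-swap (f-σ Vp)))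
    (no ¬Vp) → trans (cong σ (σ-off ¬Vp))
      (trans (σ-off (λ Vp̄ → ¬Vp (subst (_∈ vars F) (var-compl p) Vp̄))) (compl-involutive p))

  σ≢ : ∀ p → σ p ≢ p
  σ≢ p eq = case var p ∈? vars F of λ where
    (yes Vp) → compl≢ (f p) (trans (sym (f-σ Vp)) (cong f eq))
    (no ¬Vp) → compl≢ p (trans (sym (σ-off ¬Vp)) eq)

  σ-reverses : Arc F u v → Arc F (σ v) (σ u)
  σ-reverses {u} {v} a = arc⁻ (σ-LitOf (Arc-target a)) (σ-LitOf (Arc-source a))
    (subst (λ t → Arc F′ t (f (σ u))) (sym (f-σ (Arc-target a)))
      (subst (Arc F′ (compl (f v))) (sym (f-σ (Arc-source a))) (Arc-reverse (arc a))))

  On⁻ : ∀ {x y} (w : Star (Arc F) x y) → LitOf F u → LitOf F v →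
        f u ≡ u′ → f v ≡ v′ → On {E = Arc F′} u′ v′ (gmap f arc w) → On u v w
  On⁻ w Vu Vv fu fv o with On-gmap arc w o
  ... | u₀ , v₀ , o₀ , fu₀ , fv₀
    with f-inj _ _ (Arc-source (On⇒E w o₀)) Vu (trans fu₀ (sym fu))
       | f-inj _ _ (Arc-target (On⇒E w o₀)) Vv (trans fv₀ (sym fv))
  ... | refl | refl = o₀

  -- The closed walk is mapped to `F′`, where `covers-compl` applies, and the arc found there is
  -- pulled back.
  σ-covers : ∀ {x y} → y ≡ σ x → (p : Star (Arc F) x y) (q : Star (Arc F) y x) → Arc F u v →
             (On u v p ⊎ On u v q) ⊎ (On (σ v) (σ u) p ⊎ On (σ v) (σ u) q)
  σ-covers {x = x} refl p q a = Sum.map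
    (Sum.map (On⁻ p Vu Vv refl refl) (On⁻ q Vu Vv refl refl))
    (Sum.map (On⁻ p (σ-LitOf Vv) (σ-LitOf Vu) (f-σ Vv) (f-σ Vu))
             (On⁻ q (σ-LitOf Vv) (σ-LitOf Vu) (f-σ Vv) (f-σ Vu)))
    -- `p` is nonempty, so `x` is the source of an arc and thus a vertex, as `f-σ` needs.
    (covers-compl mu′ (f-σ (Arc-source (first-arc {d = x} (λ x≡σx → σ≢ x (sym x≡σx)) p)))
      (gmap f arc p) (gmap f arc q) (arc a))
    where
    Vu = Arc-source a
    Vv = Arc-target a

  σ-minimalSkew : MinimalSkew {E = Arc F} σ
  σ-minimalSkew = record
    { involutive = σ-involutive
    ; reverses   = σ-reverses
    ; σx≢x       = σ≢
    ; covers     = σ-covers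
    }

digraphIso-compl : 2 ≤ k → Is2CNF F → MinUnsat F → MinUnsat F′ → HasDeficiency F k →
                   ∀ {f} → IsDigraphIso F F′ f → ∀ x → LitOf F x → f (compl x) ≡ compl (f x)
digraphIso-compl 2≤k f2 mu mu′ def {f} iso x Vx =
  trans (cong f (minimalSkew-unique 2≤k f2 mu def σ-minimalSkew Vx)) (f-σ Vx)
  where open Transport mu′ iso

-- The two notions of isomorphism.

nonempty-arc : Clause₂ C → C ≢ [] → ∃₂ λ u v → ArcFrom C u v
nonempty-arc {[]}    _ C≢[] = contradiction refl C≢[]
nonempty-arc {p ∷ C} c _    = let q , _ , a = ∈⇒ArcFrom c (here refl) in compl p , q , a

map-≈C : ∀ {f : Lit → Lit} C D → f (compl u) ≡ compl (f u) → ArcFrom C u v → ArcFrom D (f u) (f v) →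
         map f C ≈C D
map-≈C {u} {v} {f} C D f-compl a a′ l = mk⇔ to from
  where
  to : l ∈ map f C → l ∈ D
  to l∈ with ∈-map⁻ f l∈
  ... | p , p∈C , refl = Equivalence.from (ArcFrom⇒∈⇔ {D} a′ (f p)) (Sum.map
          (λ p≡ → trans (cong f p≡) f-compl) (cong f) (Equivalence.to (ArcFrom⇒∈⇔ {C} a p) p∈C))
  from : l ∈ D → l ∈ map f C
  from l∈ with Equivalence.to (ArcFrom⇒∈⇔ {D} a′ l) l∈
  ... | inj₁ refl = subst (_∈ map f C) f-compl (∈-map⁺ f (ArcFrom-source C a))
  ... | inj₂ refl = ∈-map⁺ f (ArcFrom-target C a)

isIso⇒isDigraphIso : Is2CNF F → Is2CNF F′ → ∀ {f} → IsIso F F′ f → IsDigraphIso F F′ f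
isIso⇒isDigraphIso {F} {F′} (two , _) (two′ , _) {f} (bij@(_ , inj , _) , f-compl , to , from) =
  bij , arc , arc⁻
  where
  arc : ∀ u v → Arc F u v → Arc F′ (f u) (f v)
  arc u v a with find a
  ... | C , C∈F , aC with to C C∈F
  -- The literals of `D` are `f (compl u)` and `f v`; commutation with `compl` turns the source of
  -- the resulting arc into `f u`.
  ... | D , D∈F′ , C≈D = lose D∈F′ (subst (λ t → ArcFrom D t (f v)) (compl-swap (f-compl u (Arc-source a)))
        (∈⇔⇒ArcFrom (All.lookup two′ D∈F′) (image (ArcFrom-source C aC)) (image (ArcFrom-target C aC)) only))
    where
    image : p ∈ C → f p ∈ D
    image {p} p∈C = Equivalence.to (C≈D (f p)) (∈-map⁺ f p∈C)
    only : ∀ l → l ∈ D → l ≡ f (compl u) ⊎ l ≡ f v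
    only l l∈D with ∈-map⁻ f (Equivalence.from (C≈D l) l∈D)
    ... | p , p∈C , refl = Sum.map (cong f) (cong f) (Equivalence.to (ArcFrom⇒∈⇔ {C} aC p) p∈C)
  arc⁻ : ∀ u′ v′ → Arc F′ u′ v′ → ∃ λ u → ∃ λ v → Arc F u v × f u ≡ u′ × f v ≡ v′
  arc⁻ u′ v′ a with find a
  ... | D , D∈F′ , aD with from D D∈F′
  ... | C , C∈F , C≈D
    with ∈-map⁻ f (Equivalence.from (C≈D (compl u′)) (ArcFrom-source D aD))
       | ∈-map⁻ f (Equivalence.from (C≈D v′) (ArcFrom-target D aD))
  ... | p , p∈C , fp | q , q∈C , refl =
        compl p , q , lose C∈F (∈⇔⇒ArcFrom (All.lookup two C∈F) p∈C q∈C only)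
      , trans (f-compl p Vp) (compl-swap (sym fp)) , refl
    where
    V : l ∈ C → LitOf F l
    V = ∈⇒LitOf C∈F
    Vp = V p∈C
    only : ∀ l → l ∈ C → l ≡ p ⊎ l ≡ q
    only l l∈C = Sum.map (λ eq → inj l p (V l∈C) Vp (trans eq fp)) (inj l q (V l∈C) (V q∈C))
      (Equivalence.to (ArcFrom⇒∈⇔ {D} aD (f l)) (Equivalence.to (C≈D (f l)) (∈-map⁺ f l∈C)))

-- Every clause is nonempty and gives an arc, and an arc determines its clause as a set. Since `f`
-- commutes with `compl`, corresponding arcs come from corresponding clauses.
isDigraphIso⇒isIso : 2 ≤ k → Is2CNF F → Is2CNF F′ → MinUnsat F → MinUnsat F′ →
                     HasDeficiency F k → HasDeficiency F′ k → ∀ {f} → IsDigraphIso F F′ f → IsIso F F′ f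
isDigraphIso⇒isIso {k} {F} {F′} 2≤k f2 f2′ mu mu′ def def′ {f} iso@(bij , arc , arc⁻) =
  bij , f-compl , to , from
  where
  f-compl = digraphIso-compl 2≤k f2 mu mu′ def iso
  to : ∀ C → C ∈ F → ∃ λ D → D ∈ F′ × (map f C ≈C D)
  to C C∈F =
    let u , v , a = nonempty-arc (All.lookup (proj₁ f2) C∈F) (λ { refl → []∉ 2≤k mu def C∈F })
        e = lose C∈F a
        D , D∈F′ , a′ = find (arc u v e)
    in D , D∈F′ , map-≈C C D (f-compl u (Arc-source e)) a a′
  from : ∀ D → D ∈ F′ → ∃ λ C → C ∈ F × (map f C ≈C D)
  from D D∈F′ with nonempty-arc (All.lookup (proj₁ f2′) D∈F′) (λ { refl → []∉ 2≤k mu′ def′ D∈F′ })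
  ... | u′ , v′ , a′ with arc⁻ u′ v′ (lose D∈F′ a′)
  ... | u , v , e , refl , refl =
    let C , C∈F , a = find e in C , C∈F , map-≈C C D (f-compl u (Arc-source e)) a a′

theorem7p8 : (k : ℕ) → 2 ≤ k → (F F' : CNF) →
    Is2CNF F → Is2CNF F' → MinUnsat F → MinUnsat F' →
    HasDeficiency F k → HasDeficiency F' k →
    (f : Lit → Lit) → IsIso F F' f ⇔ IsDigraphIso F F' f
theorem7p8 k 2≤k F F' f2 f2′ mu mu′ def def′ f =
  mk⇔ (isIso⇒isDigraphIso f2 f2′) (isDigraphIso⇒isIso 2≤k f2 f2′ mu mu′ def def′)
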